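{- There is an infinite sequence of input instances $\mathcal{I}_1,\mathcal{I}_2,\dots$ of online facility location in the random-order model, with increasing number of demand points and decreasing distances between the demand points, such that the competitive ratio of DistProb on $\mathcal{I}_k$, i.e. $\mathrm{E}[\mathrm{ALG}(\mathcal{I}_k)]/\mathrm{OPT}(\mathcal{I}_k)$ where $\mathrm{ALG}(\mathcal{I}_k)$ is the total cost of DistProb on $\mathcal{I}_k$, approaches $4$ as $k\to\infty$.
   Context: Facility location: an instance is $\mathcal{I}=(M,d,U)$, where $(M,d)$ is a metric space and $U$ is a (finite, nonempty) multiset of $n$ demand points in $M$ (copies are treated as distinct demands). A facility may be opened at any point of $M$ at cost $1$. For $F\subseteq M$, $d(F,v)=\min_{u\in F}d(u,v)$ and $d(\emptyset,v)=\infty$. The cost of a set of facilities $F\subseteq M$ is $|F|+\sum_{v\in U}d(F,v)$; $\mathrm{OPT}(\mathcal{I})$ is the minimum cost. Random-order online model: the demands arrive as a uniformly random permutation $v_1,\dots,v_n$ of $U$. With $F_\ell$ the set of facilities opened by the algorithm by the end of round $\ell$ ($F_0=\emptyset$), its total cost is $|F_n|+\sum_{\ell=1}^n d(F_\ell,v_\ell)$. Expectations are over the arrival order and the coin flips of the algorithm. DistProb: when $v_\ell$ arrives, with probability $\min\{d(F_{\ell-1},v_\ell),1\}$ (fresh independent coin) set $F_\ell=F_{\ell-1}\cup\{v_\ell\}$ (paying $1$ for opening a facility at $v_\ell$), otherwise set $F_\ell=F_{\ell-1}$; assign $v_\ell$ to its nearest facility in $F_\ell$. -}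

module Defs where

open import Data.Bool using (Bool; true; false; if_then_else_)
open import Data.Empty using (⊥)
open import Data.Fin using (Fin)
open import Data.List using (List; []; _∷_; [_]; _++_; map; concatMap; foldr; length)
open import Data.List.Relation.Unary.Unique.Propositional using (Unique)
open import Data.Nat as ℕ using (ℕ; suc)
import Data.Nat.Properties as ℕₚ
open import Data.Integer using (+_)
open import Data.Product using (_×_; _,_; ∃₂; Σ-syntax)
open import Data.Rational as ℚ using (ℚ; 0ℚ; 1ℚ; ½)
import Data.Rational.Properties as ℚₚ
open import Data.Rational.Solver using (module +-*-Solver)
open import Data.Sum using (inj₁; inj₂)
open import Data.Unit using (⊤)
open import Data.Vec using (Vec; lookup; toList)
open import Relation.Binary.PropositionalEquality
  using (_≡_; _≢_; refl; sym; trans; cong; subst; module ≡-Reasoning)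

------------------------------------------------------------------------
-- Rational estimates used to show that the operations on ℝ are well defined

-- Equivalent to ∣ p - q ∣ ≤ δ.
Close : ℚ → ℚ → ℚ → Set
Close δ p q = p ℚ.≤ q ℚ.+ δ × q ℚ.≤ p ℚ.+ δ

abstract

  p-q+q : ∀ p q → (p ℚ.- q) ℚ.+ q ≡ p
  p-q+q = solve 2 (λ p q → (p :- q) :+ q := p) refl
    where open +-*-Solver

  ≤-shift : ∀ {δ} p q → p ℚ.- q ℚ.≤ δ → p ℚ.≤ q ℚ.+ δ
  ≤-shift {δ} p q h = begin
    p                 ≡⟨ p-q+q p q ⟨
    (p ℚ.- q) ℚ.+ q   ≤⟨ ℚₚ.+-monoˡ-≤ q h ⟩
    δ ℚ.+ q           ≡⟨ ℚₚ.+-comm δ q ⟩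
    q ℚ.+ δ           ∎
    where open ℚₚ.≤-Reasoning

  ≤-unshift : ∀ {δ} p q → p ℚ.≤ q ℚ.+ δ → p ℚ.- q ℚ.≤ δ
  ≤-unshift {δ} p q h = begin
    p ℚ.- q           ≤⟨ ℚₚ.+-monoˡ-≤ (ℚ.- q) h ⟩
    (q ℚ.+ δ) ℚ.- q   ≡⟨ solve 2 (λ q δ → (q :+ δ) :- q := δ) refl q δ ⟩
    δ                 ∎
    where open ℚₚ.≤-Reasoning
          open +-*-Solver

  p≤∣p∣ : ∀ p → p ℚ.≤ ℚ.∣ p ∣
  p≤∣p∣ p with ℚₚ.≤-total 0ℚ p
  ... | inj₁ 0≤p = ℚₚ.≤-reflexive (sym (ℚₚ.0≤p⇒∣p∣≡p 0≤p))
  ... | inj₂ p≤0 = ℚₚ.≤-trans p≤0 (ℚₚ.0≤∣p∣ p)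

  ∣p-q∣≡∣q-p∣ : ∀ p q → ℚ.∣ p ℚ.- q ∣ ≡ ℚ.∣ q ℚ.- p ∣
  ∣p-q∣≡∣q-p∣ p q = begin
    ℚ.∣ p ℚ.- q ∣         ≡⟨ cong ℚ.∣_∣ (solve 2 (λ p q → p :- q := :- (q :- p)) refl p q) ⟩
    ℚ.∣ ℚ.- (q ℚ.- p) ∣   ≡⟨ ℚₚ.∣-p∣≡∣p∣ (q ℚ.- p) ⟩
    ℚ.∣ q ℚ.- p ∣         ∎
    where open ≡-Reasoning
          open +-*-Solver

  0≤q-p : ∀ {p q} → p ℚ.≤ q → 0ℚ ℚ.≤ q ℚ.- p
  0≤q-p {p} {q} p≤q = subst (ℚ._≤ q ℚ.- p) (ℚₚ.+-inverseʳ p) (ℚₚ.+-monoˡ-≤ (ℚ.- p) p≤q)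

  ∣∣⇒Close : ∀ {δ} p q → ℚ.∣ p ℚ.- q ∣ ℚ.≤ δ → Close δ p q
  ∣∣⇒Close p q h =
    ≤-shift p q (ℚₚ.≤-trans (p≤∣p∣ (p ℚ.- q)) h) ,
    ≤-shift q p (ℚₚ.≤-trans (p≤∣p∣ (q ℚ.- p)) (subst (ℚ._≤ _) (∣p-q∣≡∣q-p∣ p q) h))

  Close⇒∣∣ : ∀ {δ} p q → Close δ p q → ℚ.∣ p ℚ.- q ∣ ℚ.≤ δ
  Close⇒∣∣ p q (h₁ , h₂) with ℚₚ.≤-total q p
  ... | inj₁ q≤p = subst (ℚ._≤ _) (sym (ℚₚ.0≤p⇒∣p∣≡p (0≤q-p q≤p))) (≤-unshift p q h₁)
  ... | inj₂ p≤q = subst (ℚ._≤ _) (sym (trans (∣p-q∣≡∣q-p∣ p q) (ℚₚ.0≤p⇒∣p∣≡p (0≤q-p p≤q))))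
                         (≤-unshift q p h₂)

  ⊓-shift : ∀ {δ} a b c d → a ℚ.≤ c ℚ.+ δ → b ℚ.≤ d ℚ.+ δ → a ℚ.⊓ b ℚ.≤ (c ℚ.⊓ d) ℚ.+ δ
  ⊓-shift a b c d h₁ h₂ with ℚₚ.⊓-sel c d
  ... | inj₁ e rewrite e = ℚₚ.≤-trans (ℚₚ.p⊓q≤p a b) h₁
  ... | inj₂ e rewrite e = ℚₚ.≤-trans (ℚₚ.p⊓q≤q a b) h₂

  ∣⊓-⊓∣≤ : ∀ {δ} a b c d → ℚ.∣ a ℚ.- c ∣ ℚ.≤ δ → ℚ.∣ b ℚ.- d ∣ ℚ.≤ δ →
           ℚ.∣ (a ℚ.⊓ b) ℚ.- (c ℚ.⊓ d) ∣ ℚ.≤ δ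
  ∣⊓-⊓∣≤ {δ} a b c d h k =
    let h₁ , h₂ = ∣∣⇒Close {δ} a c h
        k₁ , k₂ = ∣∣⇒Close {δ} b d k
    in Close⇒∣∣ {δ} (a ℚ.⊓ b) (c ℚ.⊓ d)
         (⊓-shift {δ} a b c d h₁ k₁ , ⊓-shift {δ} c d a b h₂ k₂)

  ∣∣-shift : ∀ p q → ℚ.∣ p ∣ ℚ.≤ ℚ.∣ q ∣ ℚ.+ ℚ.∣ p ℚ.- q ∣
  ∣∣-shift p q = begin
    ℚ.∣ p ∣                       ≡⟨ cong ℚ.∣_∣ (p-q+q p q) ⟨
    ℚ.∣ (p ℚ.- q) ℚ.+ q ∣         ≤⟨ ℚₚ.∣p+q∣≤∣p∣+∣q∣ (p ℚ.- q) q ⟩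
    ℚ.∣ p ℚ.- q ∣ ℚ.+ ℚ.∣ q ∣     ≡⟨ ℚₚ.+-comm ℚ.∣ p ℚ.- q ∣ ℚ.∣ q ∣ ⟩
    ℚ.∣ q ∣ ℚ.+ ℚ.∣ p ℚ.- q ∣     ∎
    where open ℚₚ.≤-Reasoning

  ∣∣p∣-∣q∣∣≤ : ∀ p q → ℚ.∣ ℚ.∣ p ∣ ℚ.- ℚ.∣ q ∣ ∣ ℚ.≤ ℚ.∣ p ℚ.- q ∣
  ∣∣p∣-∣q∣∣≤ p q = Close⇒∣∣ ℚ.∣ p ∣ ℚ.∣ q ∣
    (∣∣-shift p q , subst (λ t → ℚ.∣ q ∣ ℚ.≤ ℚ.∣ p ∣ ℚ.+ t) (∣p-q∣≡∣q-p∣ q p) (∣∣-shift q p))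

  ∣+-+∣≤ : ∀ {δ η} a b c d → ℚ.∣ a ℚ.- c ∣ ℚ.≤ δ → ℚ.∣ b ℚ.- d ∣ ℚ.≤ η →
           ℚ.∣ (a ℚ.+ b) ℚ.- (c ℚ.+ d) ∣ ℚ.≤ δ ℚ.+ η
  ∣+-+∣≤ {δ} {η} a b c d h k = begin
    ℚ.∣ (a ℚ.+ b) ℚ.- (c ℚ.+ d) ∣        ≡⟨ cong ℚ.∣_∣ (solve 4 (λ a b c d →
                                             (a :+ b) :- (c :+ d) := (a :- c) :+ (b :- d)) refl a b c d) ⟩
    ℚ.∣ (a ℚ.- c) ℚ.+ (b ℚ.- d) ∣        ≤⟨ ℚₚ.∣p+q∣≤∣p∣+∣q∣ (a ℚ.- c) (b ℚ.- d) ⟩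
    ℚ.∣ a ℚ.- c ∣ ℚ.+ ℚ.∣ b ℚ.- d ∣      ≤⟨ ℚₚ.+-mono-≤ h k ⟩
    δ ℚ.+ η                              ∎
    where open ℚₚ.≤-Reasoning
          open +-*-Solver

  ∣*∣≤ : ∀ {B δ} p q → ℚ.∣ p ∣ ℚ.≤ B → ℚ.∣ q ∣ ℚ.≤ δ → ℚ.∣ p ℚ.* q ∣ ℚ.≤ B ℚ.* δ
  ∣*∣≤ {B} {δ} p q h k = begin
    ℚ.∣ p ℚ.* q ∣           ≡⟨ ℚₚ.∣p*q∣≡∣p∣*∣q∣ p q ⟩
    ℚ.∣ p ∣ ℚ.* ℚ.∣ q ∣     ≤⟨ ℚₚ.*-monoʳ-≤-nonNeg ℚ.∣ q ∣ {{ℚₚ.∣-∣-nonNeg q}} h ⟩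
    B ℚ.* ℚ.∣ q ∣           ≤⟨ ℚₚ.*-monoˡ-≤-nonNeg B {{ℚ.nonNegative (ℚₚ.≤-trans (ℚₚ.0≤∣p∣ p) h)}} k ⟩
    B ℚ.* δ                 ∎
    where open ℚₚ.≤-Reasoning

  ∣*-*∣≤ : ∀ {A B δ η} a b c d → ℚ.∣ a ∣ ℚ.≤ A → ℚ.∣ d ∣ ℚ.≤ B →
           ℚ.∣ a ℚ.- c ∣ ℚ.≤ δ → ℚ.∣ b ℚ.- d ∣ ℚ.≤ η →
           ℚ.∣ (a ℚ.* b) ℚ.- (c ℚ.* d) ∣ ℚ.≤ A ℚ.* η ℚ.+ B ℚ.* δ
  ∣*-*∣≤ {A} {B} {δ} {η} a b c d ha hd h k = begin
    ℚ.∣ (a ℚ.* b) ℚ.- (c ℚ.* d) ∣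
      ≡⟨ cong ℚ.∣_∣ (solve 4 (λ a b c d →
           (a :* b) :- (c :* d) := (a :* (b :- d)) :+ (d :* (a :- c))) refl a b c d) ⟩
    ℚ.∣ a ℚ.* (b ℚ.- d) ℚ.+ d ℚ.* (a ℚ.- c) ∣
      ≤⟨ ℚₚ.∣p+q∣≤∣p∣+∣q∣ (a ℚ.* (b ℚ.- d)) (d ℚ.* (a ℚ.- c)) ⟩
    ℚ.∣ a ℚ.* (b ℚ.- d) ∣ ℚ.+ ℚ.∣ d ℚ.* (a ℚ.- c) ∣
      ≤⟨ ℚₚ.+-mono-≤ (∣*∣≤ a (b ℚ.- d) ha k) (∣*∣≤ d (a ℚ.- c) hd h) ⟩
    A ℚ.* η ℚ.+ B ℚ.* δ ∎
    where open ℚₚ.≤-Reasoning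
          open +-*-Solver

  ½*pos : ∀ {ε} → 0ℚ ℚ.< ε → 0ℚ ℚ.< ½ ℚ.* ε
  ½*pos {ε} 0<ε = ℚₚ.positive⁻¹ (½ ℚ.* ε) {{ℚₚ.pos*pos⇒pos ½ ε {{ℚ.positive 0<ε}}}}

  ½+½ : ∀ ε → ½ ℚ.* ε ℚ.+ ½ ℚ.* ε ≡ ε
  ½+½ ε = trans (sym (ℚₚ.*-distribʳ-+ ε ½ ½)) (ℚₚ.*-identityˡ ε)

  -- The positive rational η with B * η = ε.
  quotient : ∀ {ε B} → 0ℚ ℚ.< ε → 0ℚ ℚ.< B → Σ[ η ∈ ℚ ] (0ℚ ℚ.< η × B ℚ.* η ≡ ε)
  quotient {ε} {B} 0<ε 0<B = η , 0<η , B*η≡ε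
    where
    instance
      B>0 : ℚ.Positive B
      B>0 = ℚ.positive 0<B
      B≠0 : ℚ.NonZero B
      B≠0 = ℚₚ.pos⇒nonZero B
    η : ℚ
    η = ℚ.1/ B ℚ.* ε
    0<η : 0ℚ ℚ.< η
    0<η = ℚₚ.positive⁻¹ η {{ℚₚ.pos*pos⇒pos (ℚ.1/ B) {{ℚₚ.1/pos⇒pos B}} ε {{ℚ.positive 0<ε}}}}
    B*η≡ε : B ℚ.* η ≡ ε
    B*η≡ε = trans (sym (ℚₚ.*-assoc B (ℚ.1/ B) ε))
           (trans (cong (ℚ._* ε) (ℚₚ.*-inverseʳ B)) (ℚₚ.*-identityˡ ε))

------------------------------------------------------------------------
-- Real numbers: Cauchy sequences of rationals, with equality _≃_

IsCauchy : (ℕ → ℚ) → Set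
IsCauchy x = ∀ ε → 0ℚ ℚ.< ε →
  Σ[ N ∈ ℕ ] (∀ m n → N ℕ.≤ m → N ℕ.≤ n → ℚ.∣ x m ℚ.- x n ∣ ℚ.≤ ε)

record ℝ : Set where
  constructor mkℝ
  field
    seq    : ℕ → ℚ
    cauchy : IsCauchy seq

open ℝ public

infix  4 _≃_ _≤_ _<_
infixl 6 _+_ _-_
infixl 7 _*_ _⊓_

_≃_ : ℝ → ℝ → Set
x ≃ y = ∀ ε → 0ℚ ℚ.< ε → Σ[ N ∈ ℕ ] (∀ n → N ℕ.≤ n → ℚ.∣ seq x n ℚ.- seq y n ∣ ℚ.≤ ε)

_≤_ : ℝ → ℝ → Set
x ≤ y = ∀ ε → 0ℚ ℚ.< ε → Σ[ N ∈ ℕ ] (∀ n → N ℕ.≤ n → seq x n ℚ.≤ seq y n ℚ.+ ε)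

_<_ : ℝ → ℝ → Set
x < y = Σ[ δ ∈ ℚ ] (0ℚ ℚ.< δ × Σ[ N ∈ ℕ ] (∀ n → N ℕ.≤ n → seq x n ℚ.+ δ ℚ.≤ seq y n))

fromℚ : ℚ → ℝ
fromℚ q = mkℝ (λ _ → q) λ ε 0<ε → 0 , λ _ _ _ _ →
  subst (λ t → ℚ.∣ t ∣ ℚ.≤ ε) (sym (ℚₚ.+-inverseʳ q)) (ℚₚ.<⇒≤ 0<ε)

fromℕ : ℕ → ℝ
fromℕ n = fromℚ (+ n ℚ./ 1)

0ℝ 1ℝ : ℝ
0ℝ = fromℚ 0ℚ
1ℝ = fromℚ 1ℚ

_+_ : ℝ → ℝ → ℝ
x + y = mkℝ (λ n → seq x n ℚ.+ seq y n) λ ε 0<ε →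
  let N₁ , f = cauchy x (½ ℚ.* ε) (½*pos 0<ε)
      N₂ , g = cauchy y (½ ℚ.* ε) (½*pos 0<ε)
  in N₁ ℕ.⊔ N₂ , λ m n hm hn →
     subst (_ ℚ.≤_) (½+½ ε)
       (∣+-+∣≤ (seq x m) (seq y m) (seq x n) (seq y n)
         (f m n (ℕₚ.m⊔n≤o⇒m≤o N₁ N₂ hm) (ℕₚ.m⊔n≤o⇒m≤o N₁ N₂ hn))
         (g m n (ℕₚ.m⊔n≤o⇒n≤o N₁ N₂ hm) (ℕₚ.m⊔n≤o⇒n≤o N₁ N₂ hn)))

-_ : ℝ → ℝ
- x = mkℝ (λ n → ℚ.- seq x n) λ ε 0<ε →
  let N , f = cauchy x ε 0<ε
  in N , λ m n hm hn →
     subst (ℚ._≤ ε)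
       (cong ℚ.∣_∣ (solve 2 (λ a b → b :- a := (:- a) :- (:- b)) refl (seq x m) (seq x n)))
       (f n m hn hm)
  where open +-*-Solver

_-_ : ℝ → ℝ → ℝ
x - y = x + (- y)

bound : ∀ x → Σ[ B ∈ ℚ ] (0ℚ ℚ.< B × Σ[ N ∈ ℕ ] (∀ n → N ℕ.≤ n → ℚ.∣ seq x n ∣ ℚ.≤ B))
bound x =
  let N , f = cauchy x 1ℚ 0<1
      b     = ℚ.∣ seq x N ∣
  in b ℚ.+ 1ℚ ,
     ℚₚ.+-mono-≤-< (ℚₚ.0≤∣p∣ (seq x N)) 0<1 ,
     N , λ n hn → ℚₚ.≤-trans (∣∣-shift (seq x n) (seq x N))
                             (ℚₚ.+-monoʳ-≤ b (f n N hn ℕₚ.≤-refl))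
  where
  0<1 : 0ℚ ℚ.< 1ℚ
  0<1 = ℚₚ.positive⁻¹ 1ℚ

_*_ : ℝ → ℝ → ℝ
x * y = mkℝ (λ n → seq x n ℚ.* seq y n) λ ε 0<ε →
  let A , 0<A , M₁ , a   = bound x
      B , 0<B , M₂ , b   = bound y
      δ , 0<δ , Bδ       = quotient (½*pos 0<ε) 0<B
      η , 0<η , Aη       = quotient (½*pos 0<ε) 0<A
      N₁ , f             = cauchy x δ 0<δ
      N₂ , g             = cauchy y η 0<η
      M                  = M₁ ℕ.⊔ M₂
      N                  = N₁ ℕ.⊔ N₂
  in M ℕ.⊔ N , λ m n hm hn →
     let M≤m = ℕₚ.m⊔n≤o⇒m≤o M N hm
         N≤m = ℕₚ.m⊔n≤o⇒n≤o M N hm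
         M≤n = ℕₚ.m⊔n≤o⇒m≤o M N hn
         N≤n = ℕₚ.m⊔n≤o⇒n≤o M N hn
     in subst (_ ℚ.≤_) (trans (trans (cong (ℚ._+ B ℚ.* δ) Aη) (cong (½ ℚ.* ε ℚ.+_) Bδ)) (½+½ ε))
          (∣*-*∣≤ (seq x m) (seq y m) (seq x n) (seq y n)
            (a m (ℕₚ.m⊔n≤o⇒m≤o M₁ M₂ M≤m))
            (b n (ℕₚ.m⊔n≤o⇒n≤o M₁ M₂ M≤n))
            (f m n (ℕₚ.m⊔n≤o⇒m≤o N₁ N₂ N≤m) (ℕₚ.m⊔n≤o⇒m≤o N₁ N₂ N≤n))
            (g m n (ℕₚ.m⊔n≤o⇒n≤o N₁ N₂ N≤m) (ℕₚ.m⊔n≤o⇒n≤o N₁ N₂ N≤n)))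

_⊓_ : ℝ → ℝ → ℝ
x ⊓ y = mkℝ (λ n → seq x n ℚ.⊓ seq y n) λ ε 0<ε →
  let N₁ , f = cauchy x ε 0<ε
      N₂ , g = cauchy y ε 0<ε
  in N₁ ℕ.⊔ N₂ , λ m n hm hn →
     ∣⊓-⊓∣≤ (seq x m) (seq y m) (seq x n) (seq y n)
       (f m n (ℕₚ.m⊔n≤o⇒m≤o N₁ N₂ hm) (ℕₚ.m⊔n≤o⇒m≤o N₁ N₂ hn))
       (g m n (ℕₚ.m⊔n≤o⇒n≤o N₁ N₂ hm) (ℕₚ.m⊔n≤o⇒n≤o N₁ N₂ hn))

∣_∣ : ℝ → ℝ
∣ x ∣ = mkℝ (λ n → ℚ.∣ seq x n ∣) λ ε 0<ε →
  let N , f = cauchy x ε 0<ε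
  in N , λ m n hm hn → ℚₚ.≤-trans (∣∣p∣-∣q∣∣≤ (seq x m) (seq x n)) (f m n hm hn)

infix 4 _⟶_

_⟶_ : (ℕ → ℝ) → ℝ → Set
r ⟶ ℓ = ∀ ε → 0ℝ < ε → Σ[ N ∈ ℕ ] (∀ k → N ℕ.≤ k → ∣ r k - ℓ ∣ < ε)

------------------------------------------------------------------------
-- ℝ with a largest element added

data ℝ∞ : Set where
  fin : ℝ → ℝ∞
  ∞   : ℝ∞

infix  4 _≃∞_ _≤∞_
infixl 6 _+∞_
infixl 7 _⊓∞_ _·∞_

_≃∞_ : ℝ∞ → ℝ∞ → Set
fin x ≃∞ fin y = x ≃ y
∞     ≃∞ ∞     = ⊤
fin _ ≃∞ ∞     = ⊥
∞     ≃∞ fin _ = ⊥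

_≤∞_ : ℝ∞ → ℝ∞ → Set
fin x ≤∞ fin y = x ≤ y
_     ≤∞ ∞     = ⊤
∞     ≤∞ fin _ = ⊥

_+∞_ : ℝ∞ → ℝ∞ → ℝ∞
fin x +∞ fin y = fin (x + y)
fin _ +∞ ∞     = ∞
∞     +∞ _     = ∞

_⊓∞_ : ℝ∞ → ℝ∞ → ℝ∞
fin x ⊓∞ fin y = fin (x ⊓ y)
fin x ⊓∞ ∞     = fin x
∞     ⊓∞ y     = y

-- The convention for 0ℝ ·∞ ∞ is immaterial: no outcome of DistProb has
-- infinite cost, since the first demand always opens a facility.
_·∞_ : ℝ → ℝ∞ → ℝ∞
w ·∞ fin x = fin (w * x)
w ·∞ ∞     = ∞

sum∞ : List ℝ∞ → ℝ∞
sum∞ = foldr _+∞_ (fin 0ℝ)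

------------------------------------------------------------------------
-- Finitely supported probability distributions, as weighted outcomes

Dist : Set → Set
Dist A = List (ℝ × A)

infixl 1 _>>=_

return : ∀ {A} → A → Dist A
return a = [ 1ℝ , a ]

_>>=_ : ∀ {A B} → Dist A → (A → Dist B) → Dist B
μ >>= f = concatMap (λ (w , a) → map (λ (w′ , b) → w * w′ , b) (f a)) μ

coin : ℝ → Dist Bool
coin p = (p , true) ∷ (1ℝ - p , false) ∷ []

uniform : ∀ {A} → List A → Dist A
uniform []            = []
uniform as@(_ ∷ as′) = map (fromℚ (+ 1 ℚ./ suc (length as′)) ,_) as

𝔼 : ∀ {A} → (A → ℝ∞) → Dist A → ℝ∞
𝔼 f μ = sum∞ (map (λ (w , a) → w ·∞ f a) μ)

-- All orderings of a list. Equal entries at different positions count as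
-- different, so a list of length n has n! orderings, listed with repetition.
insertions : ∀ {A : Set} → A → List A → List (List A)
insertions a []       = [ [ a ] ]
insertions a (b ∷ bs) = (a ∷ b ∷ bs) ∷ map (b ∷_) (insertions a bs)

permutations : ∀ {A : Set} → List A → List (List A)
permutations []       = [ [] ]
permutations (a ∷ as) = concatMap (insertions a) (permutations as)

------------------------------------------------------------------------
-- Facility location

record MetricSpace : Set₁ where
  field
    Point      : Set
    d          : Point → Point → ℝ
    d-nonNeg   : ∀ x y → 0ℝ ≤ d x y
    d-refl     : ∀ x → d x x ≃ 0ℝ
    d-separate : ∀ x y → d x y ≃ 0ℝ → x ≡ y
    d-sym      : ∀ x y → d x y ≃ d y x
    d-triangle : ∀ x y z → d x z ≤ d x y + d y z

record Instance : Set₁ where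
  field
    space   : MetricSpace
    n       : ℕ
    {{n≢0}} : ℕ.NonZero n
    demands : Vec (MetricSpace.Point space) n

  open MetricSpace space public

  demandDist : Fin n → Fin n → ℝ
  demandDist i j = d (lookup demands i) (lookup demands j)

  -- d(F,v), with d(∅,v) = ∞.
  dist : List Point → Point → ℝ∞
  dist F v = foldr (λ u → fin (d u v) ⊓∞_) ∞ F

  cost : List Point → ℝ∞
  cost F = fin (fromℕ (length F)) +∞ sum∞ (map (dist F) (toList demands))

  -- o = OPT. Facility sets are duplicate-free lists; an infinite set has
  -- infinite cost, so it never affects the minimum.
  IsOPT : ℝ∞ → Set
  IsOPT o = (Σ[ F ∈ List Point ] (Unique F × cost F ≃∞ o))
          × (∀ F → Unique F → o ≤∞ cost F)

  -- The distribution of F_ℓ given F_{ℓ-1} = F and v_ℓ = v. For d(F,v) = ∞ the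
  -- opening probability min{∞,1} = 1 makes opening certain. The list v ∷ F
  -- represents F ∪ {v}: if v is already in F, then d(F,v) = 0 and this outcome
  -- has probability 0.
  step : List Point → Point → Dist (List Point)
  step F v with dist F v
  ... | ∞     = return (v ∷ F)
  ... | fin x = coin (x ⊓ 1ℝ) >>= λ heads → return (if heads then v ∷ F else F)

  -- Starting from facilities F and serving the given arrivals: the final
  -- facilities together with the total assignment cost Σ d(F_ℓ,v_ℓ).
  run : List Point → List Point → Dist (List Point × ℝ∞)
  run F []       = return (F , fin 0ℝ)
  run F (v ∷ vs) =
    step F v   >>= λ F′ →
    run F′ vs  >>= λ (G , c) →
    return (G , dist F′ v +∞ c)

  distProb : Dist (List Point × ℝ∞)
  distProb = uniform (permutations (toList demands)) >>= run []

  expectedALG : ℝ∞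
  expectedALG = 𝔼 (λ (F , c) → fin (fromℕ (length F)) +∞ c) distProb

  -- r = E[ALG] / OPT.
  IsCompetitiveRatio : ℝ → Set
  IsCompetitiveRatio r = ∃₂ λ (e o : ℝ) →
    expectedALG ≃∞ fin e × IsOPT (fin o) × 0ℝ < o × r * o ≃ e

open Instance using (n; IsCompetitiveRatio)

IncreasingDemands : (ℕ → Instance) → Set
IncreasingDemands 𝓘 = ∀ k → n (𝓘 k) ℕ.< n (𝓘 (suc k))

-- Every distance between two distinct demands of 𝓘 (suc k) is smaller than
-- every distance between two distinct demands of 𝓘 k.
DecreasingDistances : (ℕ → Instance) → Set
DecreasingDistances 𝓘 = ∀ k (i j : Fin (n (𝓘 k))) (i′ j′ : Fin (n (𝓘 (suc k)))) →
  i ≢ j → i′ ≢ j′ → Instance.demandDist (𝓘 (suc k)) i′ j′ < Instance.demandDist (𝓘 k) i j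

{-# OPTIONS --safe #-}

-- Take a star whose n leaves, at distance δ from the centre, are the demands. Every
-- demand after the first is at distance 2δ from all open facilities, whatever happened
-- before, so DistProb pays 2δ + (1 - 2δ)·2δ ≈ 4δ for it in expectation, in every arrival
-- order. Opening the centre costs 1 + nδ and is optimal. With δ = 1/m and n = m² the
-- ratio is 1/(m + 1) + 4(1 - 1/m)².

module Submission where

open import Defs
open import Data.Bool using (if_then_else_)
open import Data.Fin using (Fin; zero; suc)
import Data.Fin.Properties as Finₚ
open import Data.Integer as ℤ using (+_; +[1+_])
import Data.Integer.Properties as ℤₚ
open import Data.List using (List; []; _∷_; [_]; _++_; map; foldr; length)
import Data.List as List
open import Data.List.Relation.Binary.Permutation.Propositional
  using (_↭_; ↭-refl; ↭-trans; ↭-sym; prep; swap; ↭⇒↭ₛ)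
open import Data.List.Relation.Binary.Permutation.Propositional.Properties using (↭-length)
import Data.List.Relation.Binary.Permutation.Setoid.Properties as ↭ₛ
open import Data.List.Relation.Unary.All as All using (All; []; _∷_)
import Data.List.Relation.Unary.All.Properties as Allₚ
open import Data.List.Relation.Unary.AllPairs using (AllPairs; []; _∷_)
import Data.List.Relation.Unary.AllPairs.Properties as AllPairsₚ
open import Data.List.Relation.Unary.Unique.Propositional using (Unique)
open import Data.Nat as ℕ using (ℕ; zero; suc; s≤s; z≤n)
import Data.Nat.Properties as ℕₚ
open import Data.Product using (Σ; _×_; _,_; ∃₂; proj₁; proj₂)
open import Data.Rational as ℚ using (ℚ; mkℚ; 0ℚ; 1ℚ; ½)
import Data.Rational.Properties as ℚₚ
open import Data.Rational.Solver using (module +-*-Solver)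
open import Data.Rational.Unnormalised as ℚᵘ using (mkℚᵘ; *≡*; *≤*)
import Data.Rational.Unnormalised.Properties as ℚᵘₚ
open import Data.Sum using (inj₁; inj₂)
open import Data.Unit using (tt)
open import Data.Vec using (toList)
import Data.Vec as Vec
import Data.Vec.Properties as Vecₚ
open import Function using (_∘_)
open import Relation.Binary.Definitions using (Symmetric)
open import Relation.Binary.PropositionalEquality
  using (_≡_; _≢_; refl; sym; trans; cong; cong₂; subst; subst₂; ≢-sym; resp₂; setoid; module ≡-Reasoning)
open import Relation.Nullary using (¬_; does; yes; no; contradiction)

private variable
  A B : Set

-- Rational arithmetic

-- ι and 1/suc are abstract to keep the gcd computation in ℚ._/_ from unfolding.
abstract

  ι : ℕ → ℚ
  ι n = + n ℚ./ 1

  1/suc : ℕ → ℚ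
  1/suc n = + 1 ℚ./ suc n

  ι-def : ∀ n → + n ℚ./ 1 ≡ ι n
  ι-def _ = refl

  1/suc-def : ∀ n → + 1 ℚ./ suc n ≡ 1/suc n
  1/suc-def _ = refl

  ι-0 : ι 0 ≡ 0ℚ
  ι-0 = refl

  ι-1 : ι 1 ≡ 1ℚ
  ι-1 = refl

  fromℚᵘ-homo-+ : ∀ p q → ℚ.fromℚᵘ (p ℚᵘ.+ q) ≡ ℚ.fromℚᵘ p ℚ.+ ℚ.fromℚᵘ q
  fromℚᵘ-homo-+ p q = ℚₚ.toℚᵘ-injective (ℚᵘₚ.≃-trans (ℚₚ.toℚᵘ-fromℚᵘ (p ℚᵘ.+ q)) (ℚᵘₚ.≃-sym
    (ℚᵘₚ.≃-trans (ℚₚ.toℚᵘ-homo-+ (ℚ.fromℚᵘ p) (ℚ.fromℚᵘ q))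
                 (ℚᵘₚ.+-cong (ℚₚ.toℚᵘ-fromℚᵘ p) (ℚₚ.toℚᵘ-fromℚᵘ q)))))

  fromℚᵘ-homo-* : ∀ p q → ℚ.fromℚᵘ (p ℚᵘ.* q) ≡ ℚ.fromℚᵘ p ℚ.* ℚ.fromℚᵘ q
  fromℚᵘ-homo-* p q = ℚₚ.toℚᵘ-injective (ℚᵘₚ.≃-trans (ℚₚ.toℚᵘ-fromℚᵘ (p ℚᵘ.* q)) (ℚᵘₚ.≃-sym
    (ℚᵘₚ.≃-trans (ℚₚ.toℚᵘ-homo-* (ℚ.fromℚᵘ p) (ℚ.fromℚᵘ q))
                 (ℚᵘₚ.*-cong (ℚₚ.toℚᵘ-fromℚᵘ p) (ℚₚ.toℚᵘ-fromℚᵘ q)))))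

  1/2+1/2 : 1/suc 1 ℚ.+ 1/suc 1 ≡ 1ℚ
  1/2+1/2 = refl

  ι-+ : ∀ m n → ι (m ℕ.+ n) ≡ ι m ℚ.+ ι n
  ι-+ m n = trans
    (ℚₚ.fromℚᵘ-cong {mkℚᵘ (+ (m ℕ.+ n)) 0} {mkℚᵘ (+ m) 0 ℚᵘ.+ mkℚᵘ (+ n) 0}
      (*≡* (cong (ℤ._* + 1) (trans (ℤₚ.pos-+ m n)
        (sym (cong₂ ℤ._+_ (ℤₚ.*-identityʳ (+ m)) (ℤₚ.*-identityʳ (+ n))))))))
    (fromℚᵘ-homo-+ (mkℚᵘ (+ m) 0) (mkℚᵘ (+ n) 0))

  ι-* : ∀ m n → ι (m ℕ.* n) ≡ ι m ℚ.* ι n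
  ι-* m n = trans
    (ℚₚ.fromℚᵘ-cong {mkℚᵘ (+ (m ℕ.* n)) 0} {mkℚᵘ (+ m) 0 ℚᵘ.* mkℚᵘ (+ n) 0}
      (*≡* (cong (ℤ._* + 1) (ℤₚ.pos-* m n))))
    (fromℚᵘ-homo-* (mkℚᵘ (+ m) 0) (mkℚᵘ (+ n) 0))

  ι-nonNeg : ∀ n → 0ℚ ℚ.≤ ι n
  ι-nonNeg n = ℚₚ.nonNegative⁻¹ (ι n) {{ℚₚ.normalize-nonNeg n 1}}

  ι-suc : ∀ n → ι (suc n) ≡ 1ℚ ℚ.+ ι n
  ι-suc = ι-+ 1

  ι-*-1/suc : ∀ n → ι (suc n) ℚ.* 1/suc n ≡ 1ℚ
  ι-*-1/suc n = trans (sym (fromℚᵘ-homo-* (mkℚᵘ (+ suc n) 0) (mkℚᵘ (+ 1) n)))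
    (ℚₚ.fromℚᵘ-cong {mkℚᵘ (+ suc n) 0 ℚᵘ.* mkℚᵘ (+ 1) n} {mkℚᵘ (+ 1) 0}
      (*≡* (trans (ℤₚ.*-comm (+ suc n ℤ.* + 1) (+ 1)) (cong (+ 1 ℤ.*_) (ℤₚ.*-comm (+ suc n) (+ 1))))))

  0<1/suc : ∀ n → 0ℚ ℚ.< 1/suc n
  0<1/suc n = ℚₚ.positive⁻¹ (1/suc n) {{ℚₚ.normalize-pos 1 (suc n)}}

  fromℚᵘ-mono-≤ : ∀ {p q} → p ℚᵘ.≤ q → ℚ.fromℚᵘ p ℚ.≤ ℚ.fromℚᵘ q
  fromℚᵘ-mono-≤ {p} {q} p≤q = ℚₚ.toℚᵘ-cancel-≤
    (ℚᵘₚ.≤-respˡ-≃ (ℚᵘₚ.≃-sym (ℚₚ.toℚᵘ-fromℚᵘ p))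
      (ℚᵘₚ.≤-respʳ-≃ (ℚᵘₚ.≃-sym (ℚₚ.toℚᵘ-fromℚᵘ q)) p≤q))

  1/suc-anti-≤ : ∀ {m n} → m ℕ.≤ n → 1/suc n ℚ.≤ 1/suc m
  1/suc-anti-≤ {m} {n} m≤n = fromℚᵘ-mono-≤ {mkℚᵘ (+ 1) n} {mkℚᵘ (+ 1) m}
    (*≤* (ℤ.+≤+ (ℕₚ.*-monoʳ-≤ 1 (s≤s m≤n))))

  1/suc-≢ : ∀ n → 1/suc (suc n) ≢ 1/suc n
  1/suc-≢ n e with ℚₚ.fromℚᵘ-injective {mkℚᵘ (+ 1) (suc n)} {mkℚᵘ (+ 1) n} e
  ... | *≡* e′ = contradiction
    (sym (ℤₚ.+-injective (trans (sym (ℤₚ.*-identityˡ (+ suc n))) (trans e′ (ℤₚ.*-identityˡ (+ suc (suc n)))))))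
    ℕₚ.1+n≢n

  1/suc-anti-< : ∀ n → 1/suc (suc n) ℚ.< 1/suc n
  1/suc-anti-< n = ℚₚ.≰⇒> λ h → 1/suc-≢ n (ℚₚ.≤-antisym (1/suc-anti-≤ (ℕₚ.n≤1+n n)) h)

  -- A positive fraction in lowest terms has numerator at least 1, so one over its own denominator
  -- is already below it. The field `d` stores that denominator minus one, which is the argument of
  -- `1/suc`.
  1/suc-archimedean : ∀ {ε} → 0ℚ ℚ.< ε → Σ ℕ λ N → 1/suc N ℚ.≤ ε
  1/suc-archimedean {mkℚ (+ 0) _ _} (ℚ.*<* (ℤ.+<+ ()))
  1/suc-archimedean {ε@(mkℚ +[1+ p ] d _)} _ = d ,
    subst (1/suc d ℚ.≤_) (ℚₚ.fromℚᵘ-toℚᵘ ε) (fromℚᵘ-mono-≤ {mkℚᵘ (+ 1) d} {mkℚᵘ +[1+ p ] d}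
      (*≤* (ℤ.+≤+ (ℕₚ.*-monoˡ-≤ (suc d) (s≤s (z≤n {p}))))))

0≤p*q : ∀ {p q} → 0ℚ ℚ.≤ p → 0ℚ ℚ.≤ q → 0ℚ ℚ.≤ p ℚ.* q
0≤p*q {p} {q} 0≤p 0≤q = ℚₚ.nonNegative⁻¹ (p ℚ.* q)
  {{ℚₚ.nonNeg*nonNeg⇒nonNeg p {{ℚ.nonNegative 0≤p}} q {{ℚ.nonNegative 0≤q}}}}

-- Turns an inequality into a nonnegative slack and an equation, so that the ring solver can settle
-- the equation.
≤-slack : ∀ {p q s} → 0ℚ ℚ.≤ s → p ℚ.+ s ≡ q → p ℚ.≤ q
≤-slack {p} 0≤s refl = subst (ℚ._≤ p ℚ.+ _) (ℚₚ.+-identityʳ p) (ℚₚ.+-monoʳ-≤ p 0≤s)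

Σℚ : (A → ℚ) → List A → ℚ
Σℚ g = foldr (λ a s → g a ℚ.+ s) 0ℚ

Σℚ-mono : ∀ (f g : A → ℚ) {as} → All (λ a → f a ℚ.≤ g a) as → Σℚ f as ℚ.≤ Σℚ g as
Σℚ-mono f g []       = ℚₚ.≤-refl
Σℚ-mono f g (h ∷ hs) = ℚₚ.+-mono-≤ h (Σℚ-mono f g hs)

Σℚ-+ : ∀ (f g : A → ℚ) as → Σℚ (λ a → f a ℚ.+ g a) as ≡ Σℚ f as ℚ.+ Σℚ g as
Σℚ-+ f g []       = refl
Σℚ-+ f g (a ∷ as) = trans (cong (f a ℚ.+ g a ℚ.+_) (Σℚ-+ f g as))
  (solve 4 (λ x y s t → x :+ y :+ (s :+ t) := x :+ s :+ (y :+ t)) refl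
    (f a) (g a) (Σℚ f as) (Σℚ g as))
  where open +-*-Solver

Σℚ-const : ∀ c (as : List A) → Σℚ (λ _ → c) as ≡ ι (length as) ℚ.* c
Σℚ-const c []       = sym (trans (cong (ℚ._* c) ι-0) (ℚₚ.*-zeroˡ c))
Σℚ-const c (_ ∷ as) = trans (cong (c ℚ.+_) (Σℚ-const c as)) (sym
  (trans (cong (ℚ._* c) (ι-suc (length as)))
    (solve 2 (λ x c → (con 1ℚ :+ x) :* c := c :+ x :* c) refl (ι (length as)) c)))
  where open +-*-Solver

-- Real numbers represented by constant sequences

infix 4 _≐_ _≐∞_

-- Termwise equality is used instead of `_≃_` because the operations on ℝ act term by term: such
-- equations pass through them without any ε argument. All quantities of the stars below are
-- rational, so this covers them.
record _≐_ (x : ℝ) (q : ℚ) : Set where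
  constructor constant
  field
    seq≡ : ∀ n → seq x n ≡ q

open _≐_

data _≐∞_ : ℝ∞ → ℚ → Set where
  finite : ∀ {x q} → x ≐ q → fin x ≐∞ q

≐-fromℚ : ∀ q → fromℚ q ≐ q
≐-fromℚ q = constant λ _ → refl

*-≐ : ∀ {x y p q} → x ≐ p → y ≐ q → x * y ≐ p ℚ.* q
*-≐ x≐p y≐q = constant λ n → cong₂ ℚ._*_ (seq≡ x≐p n) (seq≡ y≐q n)

fromℕ-≐ : ∀ n → fromℕ n ≐ ι n
fromℕ-≐ n = constant λ _ → ι-def n

+∞-≐∞ : ∀ {x y p q} → x ≐∞ p → y ≐∞ q → x +∞ y ≐∞ p ℚ.+ q
+∞-≐∞ (finite x≐p) (finite y≐q) = finite (constant λ n → cong₂ ℚ._+_ (seq≡ x≐p n) (seq≡ y≐q n))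

⊓∞-≐∞ : ∀ {x y p q} → x ≐∞ p → y ≐∞ q → x ⊓∞ y ≐∞ p ℚ.⊓ q
⊓∞-≐∞ (finite x≐p) (finite y≐q) = finite (constant λ n → cong₂ ℚ._⊓_ (seq≡ x≐p n) (seq≡ y≐q n))

·∞-≐∞ : ∀ {w x p q} → w ≐ p → x ≐∞ q → w ·∞ x ≐∞ p ℚ.* q
·∞-≐∞ {w} w≐p (finite {x} x≐q) = finite (*-≐ {w} {x} w≐p x≐q)

sum∞-≐∞ : ∀ {f : A → ℝ∞} {g as} → All (λ a → f a ≐∞ g a) as → sum∞ (map f as) ≐∞ Σℚ g as
sum∞-≐∞ []       = finite (≐-fromℚ 0ℚ)
sum∞-≐∞ (h ∷ hs) = +∞-≐∞ h (sum∞-≐∞ hs)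

≐⇒≃ : ∀ {x y q} → x ≐ q → y ≐ q → x ≃ y
≐⇒≃ {x} {y} {q} x≐q y≐q ε 0<ε = 0 , λ n _ → subst (ℚ._≤ ε)
  (cong ℚ.∣_∣ (sym (trans (cong₂ ℚ._-_ (seq≡ x≐q n) (seq≡ y≐q n)) (ℚₚ.+-inverseʳ q)))) (ℚₚ.<⇒≤ 0<ε)

≐⇒≤ : ∀ {x y p q} → x ≐ p → y ≐ q → p ℚ.≤ q → x ≤ y
≐⇒≤ {p = p} x≐p y≐q p≤q ε 0<ε = 0 , λ n _ →
  subst₂ (λ s t → s ℚ.≤ t ℚ.+ ε) (sym (seq≡ x≐p n)) (sym (seq≡ y≐q n))
    (subst (ℚ._≤ _) (ℚₚ.+-identityʳ p) (ℚₚ.+-mono-≤ p≤q (ℚₚ.<⇒≤ 0<ε)))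

≐⇒< : ∀ {x y p q} → x ≐ p → y ≐ q → p ℚ.< q → x < y
≐⇒< {p = p} {q} x≐p y≐q p<q =
  q ℚ.- p , subst (ℚ._< q ℚ.- p) (ℚₚ.+-inverseʳ p) (ℚₚ.+-monoˡ-< (ℚ.- p) p<q) , 0 , λ n _ →
  subst₂ (λ s t → s ℚ.+ (q ℚ.- p) ℚ.≤ t) (sym (seq≡ x≐p n)) (sym (seq≡ y≐q n))
    (ℚₚ.≤-reflexive (solve 2 (λ p q → p :+ (q :- p) := q) refl p q))
  where open +-*-Solver

≐∞⇒≃∞ : ∀ {x q} → x ≐∞ q → x ≃∞ fin (fromℚ q)
≐∞⇒≃∞ {q = q} (finite {x} x≐q) = ≐⇒≃ {x} {fromℚ q} x≐q (≐-fromℚ q)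

≐∞⇒≥∞ : ∀ {x p q} → x ≐∞ q → p ℚ.≤ q → fin (fromℚ p) ≤∞ x
≐∞⇒≥∞ {p = p} (finite {x} x≐q) = ≐⇒≤ {fromℚ p} {x} (≐-fromℚ p) x≐q

-- At tolerance q/2, equality with zero would give q ≤ q/2.
0<q⇒q≄0 : ∀ {q} → 0ℚ ℚ.< q → ¬ (fromℚ q ≃ 0ℝ)
0<q⇒q≄0 {q} 0<q q≃0 = ℚₚ.<-irrefl refl (ℚₚ.<-≤-trans ½q<q q≤½q)
  where
  ½q<q : ½ ℚ.* q ℚ.< q
  ½q<q = subst₂ ℚ._<_ (ℚₚ.+-identityʳ (½ ℚ.* q)) (½+½ q) (ℚₚ.+-monoʳ-< (½ ℚ.* q) (½*pos 0<q))
  q≤½q : q ℚ.≤ ½ ℚ.* q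
  q≤½q = let N , h = q≃0 (½ ℚ.* q) (½*pos 0<q) in
    ℚₚ.≤-trans (p≤∣p∣ q) (subst (λ t → ℚ.∣ t ∣ ℚ.≤ ½ ℚ.* q) (ℚₚ.+-identityʳ q) (h N ℕₚ.≤-refl))

-- Expectations

-- Avg P μ c: c is the mean under μ of rational values related to the outcomes by P.
-- Taking P itself to be a mean turns the law of total expectation into Avg->>=.
data Avg {A : Set} (P : A → ℚ → Set) : Dist A → ℚ → Set where
  []   : Avg P [] 0ℚ
  cons : ∀ {w a μ p q c} → w ≐ p → P a q → Avg P μ c → Avg P ((w , a) ∷ μ) (p ℚ.* q ℚ.+ c)

module _ {P : A → ℚ → Set} where

  Avg-resp-≡ : ∀ {μ c d} → c ≡ d → Avg P μ c → Avg P μ d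
  Avg-resp-≡ refl x = x

  -- Means here are plain weighted sums, never divided by the total weight, so they add over
  -- concatenation.
  Avg-++ : ∀ {μ ν c d} → Avg P μ c → Avg P ν d → Avg P (μ ++ ν) (c ℚ.+ d)
  Avg-++ {d = d} []         y = Avg-resp-≡ (sym (ℚₚ.+-identityˡ d)) y
  Avg-++ {d = d} (cons {p = p} {q} {c} h k x) y =
    Avg-resp-≡ (sym (ℚₚ.+-assoc (p ℚ.* q) c d)) (cons h k (Avg-++ x y))

  Avg-scale : ∀ {w p μ c} → w ≐ p → Avg P μ c →
              Avg P (map (λ (w′ , a) → w * w′ , a) μ) (p ℚ.* c)
  Avg-scale {p = p} h []         = Avg-resp-≡ (sym (ℚₚ.*-zeroʳ p)) []
  Avg-scale {w} {p} h (cons {w′} {p = p′} {q} {c} h′ k x) = Avg-resp-≡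
    (solve 4 (λ p p′ q c → p :* p′ :* q :+ p :* c := p :* (p′ :* q :+ c)) refl p p′ q c)
    (cons (*-≐ {w} {w′} h h′) k (Avg-scale {w} h x))
    where open +-*-Solver

  Avg-return : ∀ {a q} → P a q → Avg P (return a) q
  Avg-return {q = q} k = Avg-resp-≡ (trans (ℚₚ.+-identityʳ (1ℚ ℚ.* q)) (ℚₚ.*-identityˡ q))
    (cons (≐-fromℚ 1ℚ) k [])

  Avg-uniform : ∀ {c a as} → All (λ b → P b c) (a ∷ as) → Avg P (uniform (a ∷ as)) c
  Avg-uniform {c} {_} {as} ks = Avg-resp-≡
    (trans (sym (ℚₚ.*-assoc (ι (suc (length as))) w c))
      (trans (cong (ℚ._* c) (ι-*-1/suc (length as))) (ℚₚ.*-identityˡ c)))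
    (go ks)
    where
    w = 1/suc (length as)
    -- The weight is fixed by the whole list, while the recursion runs over its tails.
    go : ∀ {bs} → All (λ b → P b c) bs →
         Avg P (map (fromℚ (+ 1 ℚ./ suc (length as)) ,_) bs) (ι (length bs) ℚ.* (w ℚ.* c))
    go []                = Avg-resp-≡ (sym (trans (cong (ℚ._* (w ℚ.* c)) ι-0) (ℚₚ.*-zeroˡ (w ℚ.* c)))) []
    go {_ ∷ bs} (k ∷ ks) = Avg-resp-≡
      (sym (trans (cong (ℚ._* (w ℚ.* c)) (ι-suc (length bs)))
        (solve 2 (λ x y → (con 1ℚ :+ x) :* y := y :+ x :* y) refl (ι (length bs)) (w ℚ.* c))))
      (cons (constant λ _ → 1/suc-def (length as)) k (go ks))
      where open +-*-Solver

Avg->>= : ∀ {P : B → ℚ → Set} (g : A → Dist B) {μ c} →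
          Avg (λ a → Avg P (g a)) μ c → Avg P (μ >>= g) c
Avg->>= g []               = []
Avg->>= g (cons {w} h k x) = Avg-++ (Avg-scale {w = w} h k) (Avg->>= g x)

𝔼-≐∞ : ∀ {f : A → ℝ∞} {μ c} → Avg (λ a q → f a ≐∞ q) μ c → 𝔼 f μ ≐∞ c
𝔼-≐∞ []           = finite (≐-fromℚ 0ℚ)
𝔼-≐∞ (cons h k x) = +∞-≐∞ (·∞-≐∞ h k) (𝔼-≐∞ x)

-- Permutations

insertions-↭ : ∀ (a : A) bs → All (_↭ a ∷ bs) (insertions a bs)
insertions-↭ a []       = ↭-refl ∷ []
insertions-↭ a (b ∷ bs) = ↭-refl ∷ Allₚ.map⁺
  (All.map (λ π↭ → ↭-trans (prep b π↭) (swap b a ↭-refl)) (insertions-↭ a bs))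

-- Carries the two facts about the leaves that the expected cost depends on, their number and their
-- pairwise distances, to every arrival order.
permutations-↭ : ∀ (as : List A) → All (_↭ as) (permutations as)
permutations-↭ []       = ↭-refl ∷ []
permutations-↭ (a ∷ as) = Allₚ.concat⁺ (Allₚ.map⁺
  (All.map (λ {π} π↭as → All.map (λ ρ↭ → ↭-trans ρ↭ (prep a π↭as)) (insertions-↭ a π))
    (permutations-↭ as)))

-- `uniform` of an empty list is the empty distribution, whose mean is 0; exhibiting a first
-- ordering excludes this case.
permutations-nonempty : ∀ (as : List A) → ∃₂ λ π πs → permutations as ≡ π ∷ πs
permutations-nonempty []       = [] , [] , refl
permutations-nonempty (a ∷ as) with permutations as | permutations-nonempty as
... | _ | []    , _ , refl = _ , _ , refl
... | _ | _ ∷ _ , _ , refl = _ , _ , refl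

AllPairs-↭ : ∀ {R : A → A → Set} → Symmetric R → ∀ {as bs} → as ↭ bs → AllPairs R as → AllPairs R bs
AllPairs-↭ {A = A} {R} s as↭bs = ↭ₛ.AllPairs-resp-↭ (setoid A) s (resp₂ R) (↭⇒↭ₛ as↭bs)

-- Stars

-- A finite distance rules out the forced opening, and `p ≤ 1` makes the truncation at 1 inactive,
-- so the coin shows heads with probability `p` itself.
step-mean : ∀ (I : Instance) {P F v p a b} → p ℚ.≤ 1ℚ → Instance.dist I F v ≐∞ p →
            P (v ∷ F) a → P F b → Avg P (Instance.step I F v) (p ℚ.* a ℚ.+ (1ℚ ℚ.- p) ℚ.* b)
step-mean I {F = F} {v} {p} {a} {b} p≤1 h ka kb with Instance.dist I F v | h
... | fin x | finite x≐p = Avg-resp-≡ (cong (p ℚ.* a ℚ.+_) (ℚₚ.+-identityʳ ((1ℚ ℚ.- p) ℚ.* b)))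
  (Avg->>= (λ heads → return (if heads then v ∷ F else F)) {coin (x ⊓ 1ℝ)}
    (cons p≐ (Avg-return ka) (cons {w = 1ℝ - x ⊓ 1ℝ} 1-p≐ (Avg-return kb) [])))
  where
  p≐ : x ⊓ 1ℝ ≐ p
  p≐ = constant λ n → trans (cong (ℚ._⊓ 1ℚ) (seq≡ x≐p n)) (ℚₚ.p≤q⇒p⊓q≡p p≤1)
  1-p≐ : 1ℝ - x ⊓ 1ℝ ≐ 1ℚ ℚ.- p
  1-p≐ = constant λ n → cong (λ s → 1ℚ ℚ.- s) (seq≡ p≐ n)

toList-tabulate : ∀ {n} (f : Fin n → A) → toList (Vec.tabulate f) ≡ List.tabulate f
toList-tabulate {n = zero}  f = refl
toList-tabulate {n = suc n} f = cong (f zero ∷_) (toList-tabulate (f ∘ suc))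

-- There are n = `suc N` leaves, and `κ` is 1/n, as `nκ≡1` records. The bound 2δ ≤ 1 keeps the
-- opening probability equal to 2δ and, in the lower bound on the optimum, limits what a facility at
-- a leaf can gain. The bound κ ≤ δ makes two leaves at least α = δ + κ apart.
module Star
  (N : ℕ) (δ κ : ℚ) (0<δ : 0ℚ ℚ.< δ) (δ+δ≤1 : δ ℚ.+ δ ℚ.≤ 1ℚ)
  (0≤κ : 0ℚ ℚ.≤ κ) (κ≤δ : κ ℚ.≤ δ) (nκ≡1 : ι (suc N) ℚ.* κ ≡ 1ℚ)
  where

  -- The star metric and its instance

  Pt : Set
  Pt = Fin (suc (suc N))

  -- zero is the centre of the star.
  arm : Pt → ℚ
  arm zero    = 0ℚ
  arm (suc _) = δ

  dℚ : Pt → Pt → ℚ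
  dℚ u v = if does (u Finₚ.≟ v) then 0ℚ else arm u ℚ.+ arm v

  0≤δ : 0ℚ ℚ.≤ δ
  0≤δ = ℚₚ.<⇒≤ 0<δ

  0≤arm : ∀ u → 0ℚ ℚ.≤ arm u
  0≤arm zero    = ℚₚ.≤-refl
  0≤arm (suc _) = 0≤δ

  dℚ-refl : ∀ u → dℚ u u ≡ 0ℚ
  dℚ-refl u with u Finₚ.≟ u
  ... | yes _  = refl
  ... | no u≢u = contradiction refl u≢u

  dℚ-≢ : ∀ {u v} → u ≢ v → dℚ u v ≡ arm u ℚ.+ arm v
  dℚ-≢ {u} {v} u≢v with u Finₚ.≟ v
  ... | yes u≡v = contradiction u≡v u≢v
  ... | no _    = refl

  0≤dℚ : ∀ u v → 0ℚ ℚ.≤ dℚ u v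
  0≤dℚ u v with u Finₚ.≟ v
  ... | yes _ = ℚₚ.≤-refl
  ... | no _  = ℚₚ.+-mono-≤ (0≤arm u) (0≤arm v)

  dℚ-sym : ∀ u v → dℚ u v ≡ dℚ v u
  dℚ-sym u v with u Finₚ.≟ v
  ... | yes refl = sym (dℚ-refl u)
  ... | no u≢v   = trans (ℚₚ.+-comm (arm u) (arm v)) (sym (dℚ-≢ (≢-sym u≢v)))

  0<dℚ : ∀ {u v} → u ≢ v → 0ℚ ℚ.< dℚ u v
  0<dℚ {u} {v} u≢v = subst (0ℚ ℚ.<_) (sym (dℚ-≢ u≢v)) (go u v u≢v)
    where
    go : ∀ u v → u ≢ v → 0ℚ ℚ.< arm u ℚ.+ arm v
    go zero    zero    0≢0 = contradiction refl 0≢0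
    go zero    (suc _) _   = ℚₚ.+-mono-≤-< ℚₚ.≤-refl 0<δ
    go (suc _) v       _   = ℚₚ.+-mono-<-≤ 0<δ (0≤arm v)

  -- If `v` differs from both ends, the right side is `arm u` + 2 `arm v` + `arm w`, which exceeds
  -- the left side by sums of nonnegative arms. The other cases are equalities.
  dℚ-triangle : ∀ u v w → dℚ u w ℚ.≤ dℚ u v ℚ.+ dℚ v w
  dℚ-triangle u v w with u Finₚ.≟ v
  ... | yes refl = ℚₚ.≤-reflexive (sym (ℚₚ.+-identityˡ (dℚ u w)))
  ... | no u≢v with v Finₚ.≟ w
  ...   | yes refl = ℚₚ.≤-reflexive (trans (dℚ-≢ u≢v) (sym (ℚₚ.+-identityʳ _)))
  ...   | no _ with u Finₚ.≟ w
  ...     | yes _ = ℚₚ.+-mono-≤ (ℚₚ.+-mono-≤ (0≤arm u) (0≤arm v)) (ℚₚ.+-mono-≤ (0≤arm v) (0≤arm w))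
  ...     | no _  = ℚₚ.+-mono-≤
    (subst (ℚ._≤ arm u ℚ.+ arm v) (ℚₚ.+-identityʳ (arm u)) (ℚₚ.+-monoʳ-≤ (arm u) (0≤arm v)))
    (subst (ℚ._≤ arm v ℚ.+ arm w) (ℚₚ.+-identityˡ (arm w)) (ℚₚ.+-monoˡ-≤ (arm w) (0≤arm v)))

  star : Instance
  star = record
    { space = record
      { Point      = Pt
      ; d          = λ u v → fromℚ (dℚ u v)
      ; d-nonNeg   = λ u v → ≐⇒≤ {0ℝ} {fromℚ (dℚ u v)} (≐-fromℚ _) (≐-fromℚ _) (0≤dℚ u v)
      ; d-refl     = λ u → ≐⇒≃ {fromℚ (dℚ u u)} {0ℝ} (constant λ _ → dℚ-refl u) (≐-fromℚ 0ℚ)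
      ; d-separate = separate
      ; d-sym      = λ u v → ≐⇒≃ {fromℚ (dℚ u v)} {fromℚ (dℚ v u)} (constant λ _ → dℚ-sym u v) (≐-fromℚ _)
      ; d-triangle = λ u v w → ≐⇒≤ {fromℚ (dℚ u w)} {fromℚ (dℚ u v) + fromℚ (dℚ v w)}
                       (≐-fromℚ _) (constant λ _ → refl) (dℚ-triangle u v w)
      }
    ; n       = suc N
    ; demands = Vec.tabulate suc
    }
    where
    separate : ∀ u v → fromℚ (dℚ u v) ≃ 0ℝ → u ≡ v
    separate u v d≃0 with u Finₚ.≟ v
    ... | yes u≡v = u≡v
    ... | no u≢v  = contradiction d≃0 (0<q⇒q≄0 (subst (0ℚ ℚ.<_) (dℚ-≢ u≢v) (0<dℚ u≢v)))

  open Instance star using (demands; demandDist; dist; cost; IsOPT; run; expectedALG)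

  demandDist-≐ : ∀ {i j} → i ≢ j → demandDist i j ≐ δ ℚ.+ δ
  demandDist-≐ {i} {j} i≢j = constant λ _ → trans
    (cong₂ dℚ (Vecₚ.lookup∘tabulate suc i) (Vecₚ.lookup∘tabulate suc j))
    (dℚ-≢ (i≢j ∘ Finₚ.suc-injective))

  leaves : List Pt
  leaves = toList demands

  leaves-All : ∀ {P : Pt → Set} → (∀ i → P (suc i)) → All P leaves
  leaves-All {P} h = subst (All P) (sym (toList-tabulate suc)) (Allₚ.tabulate⁺ h)

  leaves-AllPairs : ∀ {R : Pt → Pt → Set} → (∀ {i j} → i ≢ j → R (suc i) (suc j)) → AllPairs R leaves
  leaves-AllPairs {R} h = subst (AllPairs R) (sym (toList-tabulate suc)) (AllPairsₚ.tabulate⁺ h)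

  length-leaves : length leaves ≡ suc N
  length-leaves = Vecₚ.length-toList demands

  -- The lower bound on the optimum is LP duality: serving every leaf is worth α = δ + 1/n,
  -- and opening one facility gains at most 1 against these values.

  opt : ℚ
  opt = 1ℚ ℚ.+ ι (suc N) ℚ.* δ

  α : ℚ
  α = δ ℚ.+ κ

  0≤α : 0ℚ ℚ.≤ α
  0≤α = ℚₚ.+-mono-≤ 0≤δ 0≤κ

  α≤2δ : α ℚ.≤ δ ℚ.+ δ
  α≤2δ = ℚₚ.+-monoʳ-≤ δ κ≤δ

  nearest : Pt → List Pt → Pt → ℚ
  nearest u []      v = dℚ u v
  nearest u (w ∷ F) v = dℚ u v ℚ.⊓ nearest w F v

  dist-≐∞ : ∀ u F v → dist (u ∷ F) v ≐∞ nearest u F v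
  dist-≐∞ u []      v = finite (≐-fromℚ (dℚ u v))
  dist-≐∞ u (w ∷ F) v = ⊓∞-≐∞ (finite (≐-fromℚ (dℚ u v))) (dist-≐∞ w F v)

  cost-≐∞ : ∀ F g → All (λ v → dist F v ≐∞ g v) leaves →
            cost F ≐∞ ι (length F) ℚ.+ Σℚ g leaves
  cost-≐∞ F g h = +∞-≐∞ (finite (fromℕ-≐ (length F))) (sum∞-≐∞ h)

  -- The connection cost truncated at the dual value α. Unlike `dist` it is finite without
  -- facilities, so an induction over the facilities can start at the empty list.
  cap : List Pt → Pt → ℚ
  cap F v = foldr (λ u c → dℚ u v ℚ.⊓ c) α F

  cap≤α : ∀ F v → cap F v ℚ.≤ α
  cap≤α []      v = ℚₚ.≤-refl
  cap≤α (u ∷ F) v = ℚₚ.≤-trans (ℚₚ.p⊓q≤q (dℚ u v) (cap F v)) (cap≤α F v)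

  cap≤nearest : ∀ u F v → cap (u ∷ F) v ℚ.≤ nearest u F v
  cap≤nearest u []      v = ℚₚ.p⊓q≤p (dℚ u v) α
  cap≤nearest u (w ∷ F) v = ℚₚ.⊓-mono-≤ (ℚₚ.≤-refl {dℚ u v}) (cap≤nearest w F v)

  hit : Pt → Pt → ℚ
  hit u v = if does (u Finₚ.≟ v) then α else 0ℚ

  -- Bounds what opening a facility at the first point saves in the truncated cost of a leaf. The
  -- centre saves at most α - δ = κ at each leaf; a leaf saves at most α at itself and nothing
  -- elsewhere, since other leaves are 2δ ≥ α away.
  gain : Pt → Pt → ℚ
  gain zero      _ = κ
  gain u@(suc _) v = hit u v

  0≤gain : ∀ u v → 0ℚ ℚ.≤ gain u v
  0≤gain zero      v = 0≤κ
  0≤gain u@(suc _) v with u Finₚ.≟ v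
  ... | yes _ = 0≤α
  ... | no _  = ℚₚ.≤-refl

  α≤dℚ+gain : ∀ u i → α ℚ.≤ dℚ u (suc i) ℚ.+ gain u (suc i)
  α≤dℚ+gain zero    i = ℚₚ.≤-reflexive (cong (ℚ._+ κ) (sym (ℚₚ.+-identityˡ δ)))
  α≤dℚ+gain (suc j) i with j Finₚ.≟ i
  ... | yes _ = ℚₚ.≤-reflexive (sym (ℚₚ.+-identityˡ α))
  ... | no _  = ℚₚ.≤-trans α≤2δ (ℚₚ.≤-reflexive (sym (ℚₚ.+-identityʳ (δ ℚ.+ δ))))

  -- Either `u` attains the new minimum, and the old value was at most α, or the truncated cost is
  -- unchanged.
  cap≤cap+gain : ∀ u F i → cap F (suc i) ℚ.≤ cap (u ∷ F) (suc i) ℚ.+ gain u (suc i)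
  cap≤cap+gain u F i with ℚₚ.⊓-sel (dℚ u (suc i)) (cap F (suc i))
  ... | inj₁ e = ℚₚ.≤-trans (cap≤α F (suc i))
    (subst (λ t → α ℚ.≤ t ℚ.+ gain u (suc i)) (sym e) (α≤dℚ+gain u i))
  ... | inj₂ e = subst (λ t → cap F (suc i) ℚ.≤ t ℚ.+ gain u (suc i)) (sym e)
    (subst (ℚ._≤ cap F (suc i) ℚ.+ gain u (suc i)) (ℚₚ.+-identityʳ (cap F (suc i)))
      (ℚₚ.+-monoʳ-≤ (cap F (suc i)) (0≤gain u (suc i))))

  Σ-hit-miss : ∀ {u vs} → All (u ≢_) vs → Σℚ (hit u) vs ≡ 0ℚ
  Σ-hit-miss [] = refl
  Σ-hit-miss {u} {v ∷ _} (u≢v ∷ u∉) with u Finₚ.≟ v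
  ... | yes u≡v = contradiction u≡v u≢v
  ... | no _    = trans (ℚₚ.+-identityˡ _) (Σ-hit-miss u∉)

  -- A list without duplicates contains `u` at most once.
  Σ-hit≤α : ∀ u {vs} → Unique vs → Σℚ (hit u) vs ℚ.≤ α
  Σ-hit≤α u [] = 0≤α
  Σ-hit≤α u {v ∷ _} (v∉ ∷ vs!) with u Finₚ.≟ v
  ... | yes refl = ℚₚ.≤-reflexive (trans (cong (α ℚ.+_) (Σ-hit-miss v∉)) (ℚₚ.+-identityʳ α))
  ... | no _     = subst (ℚ._≤ α) (sym (ℚₚ.+-identityˡ _)) (Σ-hit≤α u vs!)

  -- This is dual feasibility. The centre gains nκ = 1 in total, and a leaf gains at most α ≤ 2δ ≤
  -- 1.
  Σ-gain≤1 : ∀ u → Σℚ (gain u) leaves ℚ.≤ 1ℚ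
  Σ-gain≤1 zero = ℚₚ.≤-reflexive
    (trans (Σℚ-const κ leaves) (trans (cong (λ l → ι l ℚ.* κ) length-leaves) nκ≡1))
  Σ-gain≤1 u@(suc _) = ℚₚ.≤-trans
    (Σ-hit≤α u (leaves-AllPairs (λ i≢j → i≢j ∘ Finₚ.suc-injective)))
    (ℚₚ.≤-trans α≤2δ δ+δ≤1)

  -- Without facilities the truncated costs sum to nα = nδ + 1, which is `opt`. Each further
  -- facility adds 1 to the length and lowers the sum by at most 1.
  opt≤Σ-cap+length : ∀ F → opt ℚ.≤ Σℚ (cap F) leaves ℚ.+ ι (length F)
  opt≤Σ-cap+length [] = ℚₚ.≤-reflexive (sym (trans (cong (Σℚ (cap []) leaves ℚ.+_) ι-0) (trans (ℚₚ.+-identityʳ _)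
    (trans (Σℚ-const α leaves) (trans (cong (λ l → ι l ℚ.* α) length-leaves)
      (trans (ℚₚ.*-distribˡ-+ (ι (suc N)) δ κ)
        (trans (ℚₚ.+-comm (ι (suc N) ℚ.* δ) (ι (suc N) ℚ.* κ)) (cong (ℚ._+ ι (suc N) ℚ.* δ) nκ≡1))))))))
  opt≤Σ-cap+length (u ∷ F) = begin
    opt                                                            ≤⟨ opt≤Σ-cap+length F ⟩
    Σℚ (cap F) leaves ℚ.+ ι (length F)
      ≤⟨ ℚₚ.+-monoˡ-≤ (ι (length F)) (Σℚ-mono (cap F) (λ v → cap (u ∷ F) v ℚ.+ gain u v) (leaves-All (cap≤cap+gain u F))) ⟩
    Σℚ (λ v → cap (u ∷ F) v ℚ.+ gain u v) leaves ℚ.+ ι (length F)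
      ≡⟨ cong (ℚ._+ ι (length F)) (Σℚ-+ (cap (u ∷ F)) (gain u) leaves) ⟩
    Σℚ (cap (u ∷ F)) leaves ℚ.+ Σℚ (gain u) leaves ℚ.+ ι (length F)
      ≤⟨ ℚₚ.+-monoˡ-≤ (ι (length F)) (ℚₚ.+-monoʳ-≤ (Σℚ (cap (u ∷ F)) leaves) (Σ-gain≤1 u)) ⟩
    Σℚ (cap (u ∷ F)) leaves ℚ.+ 1ℚ ℚ.+ ι (length F)
      ≡⟨ ℚₚ.+-assoc (Σℚ (cap (u ∷ F)) leaves) 1ℚ (ι (length F)) ⟩
    Σℚ (cap (u ∷ F)) leaves ℚ.+ (1ℚ ℚ.+ ι (length F))
      ≡⟨ cong (Σℚ (cap (u ∷ F)) leaves ℚ.+_) (ι-suc (length F)) ⟨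
    Σℚ (cap (u ∷ F)) leaves ℚ.+ ι (suc (length F))                 ∎
    where open ℚₚ.≤-Reasoning

  isOPT : IsOPT (fin (fromℚ opt))
  isOPT = (zero ∷ [] , [] ∷ [] , ≐∞⇒≃∞ (subst (cost [ zero ] ≐∞_) cost-centre
            (cost-≐∞ [ zero ] (λ _ → δ) (leaves-All λ _ → finite (constant λ _ → ℚₚ.+-identityˡ δ))))) ,
          λ F _ → lower F
    where
    cost-centre : ι 1 ℚ.+ Σℚ (λ _ → δ) leaves ≡ opt
    cost-centre = cong₂ ℚ._+_ ι-1 (trans (Σℚ-const δ leaves) (cong (λ l → ι l ℚ.* δ) length-leaves))
    lower : ∀ F → fin (fromℚ opt) ≤∞ cost F
    -- There is at least one demand, so opening nothing costs ∞.
    lower []      = tt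
    lower (u ∷ F) = ≐∞⇒≥∞ (cost-≐∞ (u ∷ F) (nearest u F) (leaves-All λ i → dist-≐∞ u F (suc i)))
      (ℚₚ.≤-trans (opt≤Σ-cap+length (u ∷ F)) (ℚₚ.≤-trans
        (ℚₚ.+-monoˡ-≤ (ι (suc (length F))) (Σℚ-mono (cap (u ∷ F)) (nearest u F) (leaves-All λ i → cap≤nearest u F (suc i))))
        (ℚₚ.≤-reflexive (ℚₚ.+-comm (Σℚ (nearest u F) leaves) (ι (suc (length F)))))))

  -- Expected cost of DistProb on a star

  p : ℚ
  p = δ ℚ.+ δ

  -- A demand at distance p from F costs 1 with probability p, and p otherwise.
  μ : ℚ
  μ = p ℚ.+ (1ℚ ℚ.- p) ℚ.* p

  Equidistant : List Pt → Set
  Equidistant = AllPairs (λ u v → dℚ u v ≡ p)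

  -- The invariant is that every remaining demand is at distance `p` from the open facilities. It
  -- survives either result of the coin, because the current demand is itself at distance `p` from
  -- the later ones. The accumulator `t` is the assignment cost already paid. `P` is arbitrary so
  -- that the induction hypothesis applies beneath the binds that `run` leaves pending.
  run-mean : ∀ {P : List Pt × ℝ∞ → ℚ → Set} {t} F vs →
    (∀ G {c q} → c ≐∞ q → P (G , c) (ι (length G) ℚ.+ (t ℚ.+ q))) →
    All (λ v → dist F v ≐∞ p) vs → Equidistant vs →
    Avg P (run F vs) (ι (length F) ℚ.+ t ℚ.+ ι (length vs) ℚ.* μ)
  run-mean {P} {t} F [] k [] [] = Avg-resp-≡
    (trans (solve 3 (λ l t m → l :+ (t :+ con 0ℚ) := l :+ t :+ con 0ℚ :* m) refl (ι (length F)) t μ)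
      (cong (λ z → ι (length F) ℚ.+ t ℚ.+ z ℚ.* μ) (sym ι-0)))
    (Avg-return (k F (finite (≐-fromℚ 0ℚ))))
    where open +-*-Solver
  run-mean {P} {t} F (v ∷ vs) k (h ∷ hs) (e ∷ es) = Avg-resp-≡ total
    (Avg->>= (λ F′ → run F′ vs >>= λ (G , c) → return (G , dist F′ v +∞ c)) (step-mean star {F = F} {v} δ+δ≤1 h
      (serve (v ∷ F) dist-own (All.zipWith (λ (e , h) → dist-new e h) (e , hs)))
      (serve F h hs)))
    where
    -- The rest of the run once `v` is assigned at cost `e`, which is 0 if a facility opened at `v`
    -- and `p` otherwise. The pending addition of `e` is absorbed into `t`.
    serve : ∀ F′ {e} → dist F′ v ≐∞ e → All (λ w → dist F′ w ≐∞ p) vs →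
            Avg P (run F′ vs >>= λ (G , c) → return (G , dist F′ v +∞ c))
                  (ι (length F′) ℚ.+ (t ℚ.+ e) ℚ.+ ι (length vs) ℚ.* μ)
    serve F′ {e} h hs = Avg->>= (λ (G , c) → return (G , dist F′ v +∞ c)) (run-mean
      {P = λ (G , c) → Avg P (return (G , dist F′ v +∞ c))} {t = t ℚ.+ e} F′ vs
      (λ G {c} {q} c≐q → Avg-return (subst (P (G , dist F′ v +∞ c))
        (cong (ι (length G) ℚ.+_) (sym (ℚₚ.+-assoc t e q))) (k G (+∞-≐∞ h c≐q))))
      hs es)
    dist-own : dist (v ∷ F) v ≐∞ 0ℚ
    dist-own = subst (dist (v ∷ F) v ≐∞_) (trans (cong (ℚ._⊓ p) (dℚ-refl v))
        (ℚₚ.p≤q⇒p⊓q≡p (ℚₚ.+-mono-≤ 0≤δ 0≤δ)))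
      (⊓∞-≐∞ (finite (≐-fromℚ (dℚ v v))) h)
    dist-new : ∀ {w} → dℚ v w ≡ p → dist F w ≐∞ p → dist (v ∷ F) w ≐∞ p
    dist-new {w} e h = subst (dist (v ∷ F) w ≐∞_) (trans (cong (ℚ._⊓ p) e) (ℚₚ.⊓-idem p))
      (⊓∞-≐∞ (finite (≐-fromℚ (dℚ v w))) h)
    -- The branches differ only in paying 1 for the opening or `p` for the assignment, so averaging
    -- them contributes one `μ`.
    total : p ℚ.* (ι (suc (length F)) ℚ.+ (t ℚ.+ 0ℚ) ℚ.+ ι (length vs) ℚ.* μ)
            ℚ.+ (1ℚ ℚ.- p) ℚ.* (ι (length F) ℚ.+ (t ℚ.+ p) ℚ.+ ι (length vs) ℚ.* μ)
          ≡ ι (length F) ℚ.+ t ℚ.+ ι (suc (length vs)) ℚ.* μ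
    total rewrite ι-suc (length F) | ι-suc (length vs) = solve 4 (λ p l t s →
      let m = p :+ (con 1ℚ :- p) :* p in
      p :* (con 1ℚ :+ l :+ (t :+ con 0ℚ) :+ s :* m) :+ (con 1ℚ :- p) :* (l :+ (t :+ p) :+ s :* m)
      := l :+ t :+ (con 1ℚ :+ s) :* m) refl p (ι (length F)) t (ι (length vs))
      where open +-*-Solver

  alg : ℚ
  alg = 1ℚ ℚ.+ ι N ℚ.* μ

  -- The first demand sees distance ∞, so it opens with certainty and is assigned at cost 0. This
  -- accounts for the summand 1 in `alg` and establishes the invariant for the other N demands.
  run-mean-fresh : ∀ {P : List Pt × ℝ∞ → ℚ → Set} vs →
    (∀ G {c q} → c ≐∞ q → P (G , c) (ι (length G) ℚ.+ q)) →
    Equidistant vs → length vs ≡ suc N → Avg P (run [] vs) alg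
  run-mean-fresh {P} (v ∷ vs) k (e ∷ es) len = Avg-resp-≡ total (Avg->>= (λ F → run F vs >>= λ (G , c) → return (G , dist F v +∞ c)) {return [ v ]}
    (Avg-return (Avg->>= (λ (G , c) → return (G , dist [ v ] v +∞ c)) {run [ v ] vs}
    (run-mean {P = λ (G , c) → Avg P (return (G , dist [ v ] v +∞ c))} {t = 0ℚ} [ v ] vs
      (λ G {c} {q} c≐q → Avg-return (k G (+∞-≐∞ (finite (constant λ _ → dℚ-refl v)) c≐q)))
      (All.map (λ e → finite (constant λ _ → e)) e) es))))
    where
    total : ι 1 ℚ.+ 0ℚ ℚ.+ ι (length vs) ℚ.* μ ≡ alg
    total = cong₂ (λ x l → x ℚ.+ ι l ℚ.* μ) (trans (ℚₚ.+-identityʳ (ι 1)) ι-1) (ℕₚ.suc-injective len)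

  -- Every arrival order has the same mean `alg`, hence so does the uniform mixture.
  expectedALG-≐∞ : expectedALG ≐∞ alg
  expectedALG-≐∞ = 𝔼-≐∞ (Avg->>= (run []) uniform-mean)
    where
    P : List Pt × ℝ∞ → ℚ → Set
    P (G , c) q = fin (fromℕ (length G)) +∞ c ≐∞ q
    means : All (λ π → Avg P (run [] π) alg) (permutations leaves)
    means = All.map (λ {π} π↭ → run-mean-fresh π
        (λ G c≐q → +∞-≐∞ (finite (fromℕ-≐ (length G))) c≐q)
        (AllPairs-↭ (λ {u} {v} e → trans (dℚ-sym v u) e) (↭-sym π↭)
          (leaves-AllPairs (λ i≢j → dℚ-≢ (i≢j ∘ Finₚ.suc-injective))))
        (trans (↭-length π↭) length-leaves))
      (permutations-↭ leaves)
    uniform-mean : Avg (λ π → Avg P (run [] π)) (uniform (permutations leaves)) alg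
    uniform-mean with permutations leaves | permutations-nonempty leaves | means
    ... | _ | _ , _ , refl | ms = Avg-uniform ms

-- The k-th star: m = k + 2

side : ℕ → ℕ
side k = suc (suc k)

-- This is m² - 1, written so that its successor is definitionally `side k ℕ.* side k`; `Star` takes
-- the number of leaves minus one.
pred-side² : ℕ → ℕ
pred-side² k = suc k ℕ.+ suc k ℕ.* side k

m 1/m 1/[1+m] : ℕ → ℚ
m k = ι (side k)
1/m k = 1/suc (suc k)
1/[1+m] k = 1/suc (side k)

m*1/m≡1 : ∀ k → m k ℚ.* 1/m k ≡ 1ℚ
m*1/m≡1 k = ι-*-1/suc (suc k)

[1+m]*1/[1+m]≡1 : ∀ k → (1ℚ ℚ.+ m k) ℚ.* 1/[1+m] k ≡ 1ℚ
[1+m]*1/[1+m]≡1 k = trans (cong (ℚ._* 1/[1+m] k) (sym (ι-suc (side k)))) (ι-*-1/suc (side k))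

0≤1/m : ∀ k → 0ℚ ℚ.≤ 1/m k
0≤1/m k = ℚₚ.<⇒≤ (0<1/suc (suc k))

0≤1/[1+m] : ∀ k → 0ℚ ℚ.≤ 1/[1+m] k
0≤1/[1+m] k = ℚₚ.<⇒≤ (0<1/suc (side k))

1/[1+m]≤1/m : ∀ k → 1/[1+m] k ℚ.≤ 1/m k
1/[1+m]≤1/m k = 1/suc-anti-≤ (ℕₚ.n≤1+n (suc k))

-- This is why the sequence starts at m = 2.
1/m+1/m≤1 : ∀ k → 1/m k ℚ.+ 1/m k ℚ.≤ 1ℚ
1/m+1/m≤1 k = ℚₚ.≤-trans (ℚₚ.+-mono-≤ 1/m≤1/2 1/m≤1/2) (ℚₚ.≤-reflexive 1/2+1/2)
  where
  1/m≤1/2 : 1/m k ℚ.≤ 1/suc 1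
  1/m≤1/2 = 1/suc-anti-≤ (s≤s z≤n)

1/m*1/m≤1/m : ∀ k → 1/m k ℚ.* 1/m k ℚ.≤ 1/m k
1/m*1/m≤1/m k = subst (1/m k ℚ.* 1/m k ℚ.≤_) (ℚₚ.*-identityˡ (1/m k))
  (ℚₚ.*-monoʳ-≤-nonNeg (1/m k) {{ℚ.nonNegative (0≤1/m k)}} (ℚₚ.≤-trans (≤-slack {1/m k} (0≤1/m k) refl) (1/m+1/m≤1 k)))

ι-side² : ∀ k → ι (suc (pred-side² k)) ≡ m k ℚ.* m k
ι-side² k = ι-* (side k) (side k)

n*1/m≡m : ∀ k → ι (suc (pred-side² k)) ℚ.* 1/m k ≡ m k
n*1/m≡m k = trans (cong (ℚ._* 1/m k) (ι-side² k)) (trans (ℚₚ.*-assoc (m k) (m k) (1/m k))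
  (trans (cong (m k ℚ.*_) (m*1/m≡1 k)) (ℚₚ.*-identityʳ (m k))))

n*1/m²≡1 : ∀ k → ι (suc (pred-side² k)) ℚ.* (1/m k ℚ.* 1/m k) ≡ 1ℚ
n*1/m²≡1 k = trans (sym (ℚₚ.*-assoc (ι (suc (pred-side² k))) (1/m k) (1/m k)))
  (trans (cong (ℚ._* 1/m k) (n*1/m≡m k)) (m*1/m≡1 k))

module 𝕊 k = Star (pred-side² k) (1/m k) (1/m k ℚ.* 1/m k)
  (0<1/suc (suc k)) (1/m+1/m≤1 k) (0≤p*q (0≤1/m k) (0≤1/m k)) (1/m*1/m≤1/m k) (n*1/m²≡1 k)

-- The competitive ratio and its limit

4ℚ : ℚ
4ℚ = + 4 ℚ./ 1

ratio : ℕ → ℚ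
ratio k = 1/[1+m] k ℚ.+ 4ℚ ℚ.* (1ℚ ℚ.- 1/m k) ℚ.* (1ℚ ℚ.- 1/m k)

-- With x = 1/m both sides equal 1 + 4(1 - x)(m - x). On the left `opt` is 1 + m, and (1 + m)(1 - x)
-- = m - x. On the right `μ` is 4x(1 - x), and (m² - 1)x = m - x. The relation mx = 1 is rewritten
-- by hand between the ring identities.
ratio*opt≡alg : ∀ k → ratio k ℚ.* 𝕊.opt k ≡ 𝕊.alg k
ratio*opt≡alg k = begin
  ratio k ℚ.* (1ℚ ℚ.+ ι (suc n) ℚ.* x)
    ≡⟨ cong (λ t → ratio k ℚ.* (1ℚ ℚ.+ t)) (n*1/m≡m k) ⟩
  ratio k ℚ.* (1ℚ ℚ.+ z)
    ≡⟨ solve 3 (λ x y m → (y :+ con 4ℚ :* (con 1ℚ :- x) :* (con 1ℚ :- x)) :* (con 1ℚ :+ m)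
         := (con 1ℚ :+ m) :* y :+ con 4ℚ :* (con 1ℚ :- x) :* ((con 1ℚ :+ m) :- x :- m :* x))
         refl x (1/[1+m] k) z ⟩
  (1ℚ ℚ.+ z) ℚ.* 1/[1+m] k ℚ.+ 4ℚ ℚ.* (1ℚ ℚ.- x) ℚ.* ((1ℚ ℚ.+ z) ℚ.- x ℚ.- z ℚ.* x)
    ≡⟨ cong₂ (λ s t → s ℚ.+ 4ℚ ℚ.* (1ℚ ℚ.- x) ℚ.* ((1ℚ ℚ.+ z) ℚ.- x ℚ.- t)) ([1+m]*1/[1+m]≡1 k) (m*1/m≡1 k) ⟩
  1ℚ ℚ.+ 4ℚ ℚ.* (1ℚ ℚ.- x) ℚ.* ((1ℚ ℚ.+ z) ℚ.- x ℚ.- 1ℚ)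
    ≡⟨ solve 2 (λ x m → con 1ℚ :+ con 4ℚ :* (con 1ℚ :- x) :* ((con 1ℚ :+ m) :- x :- con 1ℚ)
         := con 1ℚ :+ con 4ℚ :* (con 1ℚ :- x) :* (m :- x)) refl x z ⟩
  1ℚ ℚ.+ 4ℚ ℚ.* (1ℚ ℚ.- x) ℚ.* (z ℚ.- x)
    ≡⟨ cong (λ t → 1ℚ ℚ.+ 4ℚ ℚ.* (1ℚ ℚ.- x) ℚ.* (t ℚ.- x))
         (trans (cong (ℚ._* x) (sym (ι-suc n))) (n*1/m≡m k)) ⟨
  1ℚ ℚ.+ 4ℚ ℚ.* (1ℚ ℚ.- x) ℚ.* ((1ℚ ℚ.+ ι n) ℚ.* x ℚ.- x)
    ≡⟨ solve 2 (λ x n → con 1ℚ :+ con 4ℚ :* (con 1ℚ :- x) :* ((con 1ℚ :+ n) :* x :- x)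
         := con 1ℚ :+ n :* (x :+ x :+ (con 1ℚ :- (x :+ x)) :* (x :+ x))) refl x (ι n) ⟩
  𝕊.alg k ∎
  where
  open ≡-Reasoning
  open +-*-Solver
  n = pred-side² k
  x = 1/m k
  z = m k

isCompetitiveRatio : ∀ k → Instance.IsCompetitiveRatio (𝕊.star k) (fromℚ (ratio k))
isCompetitiveRatio k = fromℚ (𝕊.alg k) , fromℚ (𝕊.opt k) ,
  ≐∞⇒≃∞ (𝕊.expectedALG-≐∞ k) , 𝕊.isOPT k ,
  ≐⇒< {0ℝ} {fromℚ (𝕊.opt k)} (≐-fromℚ 0ℚ) (≐-fromℚ (𝕊.opt k)) 0<opt ,
  ≐⇒≃ {fromℚ (ratio k) * fromℚ (𝕊.opt k)} {fromℚ (𝕊.alg k)}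
    (constant λ _ → ratio*opt≡alg k) (≐-fromℚ (𝕊.alg k))
  where
  0<opt : 0ℚ ℚ.< 𝕊.opt k
  0<opt = ℚₚ.<-≤-trans (ℚₚ.positive⁻¹ 1ℚ) (≤-slack 0≤n*1/m refl)
    where
    0≤n*1/m : 0ℚ ℚ.≤ ι (suc (pred-side² k)) ℚ.* 1/m k
    0≤n*1/m = subst (0ℚ ℚ.≤_) (sym (n*1/m≡m k)) (ι-nonNeg (side k))

8* : ℚ → ℚ
8* x = (+ 8 ℚ./ 1) ℚ.* x

-- With x = 1/m and y = 1/(1 + m), the difference `ratio k` - 4 is y - 8x + 4x². The upper slack 16x
-- - y - 4x² is split so that y ≤ x and x² ≤ x show it nonnegative; the lower slack is y + 4x².
∣ratio-4∣≤8/m : ∀ k → ℚ.∣ ratio k ℚ.- 4ℚ ∣ ℚ.≤ 8* (1/m k)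
∣ratio-4∣≤8/m k = Close⇒∣∣ {8* (1/m k)} (ratio k) 4ℚ
  ( ≤-slack upper-slack (solve 2 (λ x y →
      y :+ con 4ℚ :* (con 1ℚ :- x) :* (con 1ℚ :- x)
        :+ ((x :- y) :+ con 4ℚ :* (x :- x :* x) :+ con (+ 11 ℚ./ 1) :* x)
      := con 4ℚ :+ con (+ 8 ℚ./ 1) :* x) refl (1/m k) (1/[1+m] k))
  , ≤-slack lower-slack (solve 2 (λ x y →
      con 4ℚ :+ (y :+ con 4ℚ :* (x :* x))
      := y :+ con 4ℚ :* (con 1ℚ :- x) :* (con 1ℚ :- x) :+ con (+ 8 ℚ./ 1) :* x) refl (1/m k) (1/[1+m] k)))
  where
  open +-*-Solver
  upper-slack : 0ℚ ℚ.≤ (1/m k ℚ.- 1/[1+m] k) ℚ.+ 4ℚ ℚ.* (1/m k ℚ.- 1/m k ℚ.* 1/m k) ℚ.+ (+ 11 ℚ./ 1) ℚ.* 1/m k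
  upper-slack = ℚₚ.+-mono-≤
    (ℚₚ.+-mono-≤ (0≤q-p (1/[1+m]≤1/m k)) (0≤p*q {4ℚ} (ℚₚ.nonNegative⁻¹ 4ℚ) (0≤q-p (1/m*1/m≤1/m k))))
    (0≤p*q {+ 11 ℚ./ 1} (ℚₚ.nonNegative⁻¹ (+ 11 ℚ./ 1)) (0≤1/m k))
  lower-slack : 0ℚ ℚ.≤ 1/[1+m] k ℚ.+ 4ℚ ℚ.* (1/m k ℚ.* 1/m k)
  lower-slack = ℚₚ.+-mono-≤ (0≤1/[1+m] k) (0≤p*q {4ℚ} (ℚₚ.nonNegative⁻¹ 4ℚ) (0≤p*q (0≤1/m k) (0≤1/m k)))

ratio⟶4 : (λ k → fromℚ (ratio k)) ⟶ fromℕ 4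
-- The rational η is eventually below ε. One half of it bounds the distance to 4, the other half is
-- the gap that a strict inequality requires.
ratio⟶4 ε (η , 0<η , N , η≤ε) = K , λ k K≤k → ½ ℚ.* η , ½*pos 0<η , N , λ n N≤n →
  ℚₚ.≤-trans (ℚₚ.+-monoˡ-≤ (½ ℚ.* η) (close k K≤k))
    (ℚₚ.≤-trans (ℚₚ.≤-reflexive (trans (½+½ η) (sym (ℚₚ.+-identityˡ η)))) (η≤ε n N≤n))
  where
  -- The four halvings give η/16, which the factor 8 turns into η/2.
  archimedean = 1/suc-archimedean (½*pos (½*pos (½*pos (½*pos 0<η))))
  K = proj₁ archimedean
  close : ∀ k → K ℕ.≤ k → ℚ.∣ ratio k ℚ.- 4ℚ ∣ ℚ.≤ ½ ℚ.* η
  close k K≤k = begin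
    ℚ.∣ ratio k ℚ.- 4ℚ ∣                     ≤⟨ ∣ratio-4∣≤8/m k ⟩
    8* (1/m k)                               ≤⟨ ℚₚ.*-monoˡ-≤-nonNeg (+ 8 ℚ./ 1)
                                                  (ℚₚ.≤-trans (1/suc-anti-≤ (ℕₚ.m≤n⇒m≤1+n K≤k)) (proj₂ archimedean)) ⟩
    8* (½ ℚ.* (½ ℚ.* (½ ℚ.* (½ ℚ.* η))))     ≡⟨ solve 1 (λ η → con (+ 8 ℚ./ 1) :*
                                                  (con ½ :* (con ½ :* (con ½ :* (con ½ :* η)))) := con ½ :* η) refl η ⟩
    ½ ℚ.* η                                  ∎
    where
    open ℚₚ.≤-Reasoning
    open +-*-Solver

theorem3p7 : Σ (ℕ → Instance) λ 𝓘 →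
    IncreasingDemands 𝓘 ×
    DecreasingDistances 𝓘 ×
    (Σ (ℕ → ℝ) λ r →
    (∀ k → Instance.IsCompetitiveRatio (𝓘 k) (r k)) × (r ⟶ fromℕ 4))
theorem3p7 = 𝕊.star ,
  (λ k → ℕₚ.*-mono-< (ℕₚ.n<1+n (side k)) (ℕₚ.n<1+n (side k))) ,
  (λ k i j i′ j′ i≢j i′≢j′ →
    ≐⇒< {Instance.demandDist (𝕊.star (suc k)) i′ j′} {Instance.demandDist (𝕊.star k) i j}
      (𝕊.demandDist-≐ (suc k) i′≢j′) (𝕊.demandDist-≐ k i≢j)
      (ℚₚ.+-mono-< (1/suc-anti-< (suc k)) (1/suc-anti-< (suc k)))) ,
  (λ k → fromℚ (ratio k)) , isCompetitiveRatio , ratio⟶4
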